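{- Let $p(n)=p_n$ denote the number of partitions of $n$ (with $p(0)=1$) and let $T_n=\tau(n+1)$ for $n\ge0$. Then for every integer $n\ge1$, $$n\,p_n=\sum_{k=1}^{n}\frac{(-1)^k}{24}\,|H_k(\overline{T})|\,p(n-k).$$
   Context: $\tau$ is Ramanujan's tau function, defined by $\sum_{n\ge1}\tau(n)q^n=q\prod_{m\ge1}(1-q^m)^{24}$. $|M|$ denotes the determinant of a square matrix $M$. For a sequence $\overline{h}=(h_0,h_1,h_2,\dots)$ with $h_0=1$, $H_n(\overline{h})$ is the $n\times n$ matrix whose first column has entries $i\,h_i$ ($1\le i\le n$), whose $(i,k)$ entry is $h_{i-k+1}$ for $2\le k\le i$, is $1$ for $k=i+1$, and is $0$ for $k>i+1$. -}

module Defs where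

open import Algebra.Bundles using (CommutativeRing)
open import Data.Bool.Base using (if_then_else_)
open import Data.Empty using (⊥-elim)
open import Data.Fin.Base using (Fin; zero; suc; toℕ)
open import Data.Fin.Properties using (toℕ<n)
open import Data.Integer.Base as ℤ using (ℤ; +_; 0ℤ; 1ℤ; -1ℤ)
import Data.Integer.Properties as ℤ
open import Data.List.Base
  using (List; []; _∷_; _++_; map; concatMap; length; replicate; upTo)
open import Data.List.Membership.Propositional using (_∈_; find; lose)
open import Data.List.Membership.Propositional.Properties
  using (∈-map⁺; ∈-map⁻; ∈-concatMap⁺; ∈-concatMap⁻; ∈-upTo⁺; ∈-upTo⁻)
open import Data.List.Properties using (∷-injectiveʳ; ++-cancelˡ)
open import Data.List.Relation.Unary.All as All using (All; []; _∷_)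
import Data.List.Relation.Unary.All.Properties as All
open import Data.List.Relation.Unary.AllPairs as AllPairs using ([]; _∷_)
import Data.List.Relation.Unary.AllPairs.Properties as AllPairs
open import Data.List.Relation.Unary.Any using (here)
open import Data.List.Relation.Unary.Linked as Linked using (Linked; [])
open import Data.List.Relation.Unary.Linked.Properties
  using (Linked⇒AllPairs; AllPairs⇒Linked)
open import Data.List.Relation.Unary.Unique.Propositional using (Unique)
import Data.List.Relation.Unary.Unique.Propositional.Properties as Unique
open import Data.Nat.Base
open import Data.Nat.DivMod
  using (_/_; m/n*n≤m; m*n/n≡m; /-monoˡ-≤)
open import Data.Nat.ListAction using (sum)
open import Data.Nat.Properties
open import Data.Product.Base using (_×_; _,_; proj₁; proj₂; ∃₂)
open import Data.Rational.Base using (ℚ)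
import Data.Rational.Properties as ℚ
open import Data.Vec.Functional using (Vector; removeAt)
open import Function.Base using (_∘_; flip)
open import Relation.Binary.PropositionalEquality
open import Relation.Nullary using (yes; no)

import Algebra.Properties.Semiring.Sum
  (CommutativeRing.semiring ℤ.+-*-commutativeRing) as ℤΣ
import Algebra.Properties.Semiring.Sum
  (CommutativeRing.semiring ℚ.+-*-commutativeRing) as ℚΣ

record IsPartition (n : ℕ) (xs : List ℕ) : Set where
  constructor isPartition
  field
    nonincreasing : Linked _≥_ xs
    positive      : All (_> 0) xs
    sums          : sum xs ≡ n

-- Enumerates the partitions of n with all parts at most b, according to the
-- multiplicity j of the part b.  That every partition is listed, and exactly
-- once, is ∈-partitions⁺, ∈-partitions⁻ and partitions-unique below.
partitions≤ : (b n : ℕ) → List (List ℕ)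
partitions≤ zero    zero    = [] ∷ []
partitions≤ zero    (suc _) = []
partitions≤ (suc b) n       =
  concatMap (λ j → map (replicate j (suc b) ++_) (partitions≤ b (n ∸ j * suc b)))
            (upTo (suc (n / suc b)))

partitions : ℕ → List (List ℕ)
partitions n = partitions≤ n n

p : ℕ → ℕ
p n = length (partitions n)

-- Formal power series in q: f n is the coefficient of q^n.
Series : Set
Series = ℕ → ℤ

infix  9 q^_
infixr 8 _^ˢ_
infixl 7 _⋆_
infixl 6 _-ˢ_

q^_ : ℕ → Series
(q^ m) n = if m ≡ᵇ n then 1ℤ else 0ℤ

1ˢ : Series
1ˢ = q^ 0

_-ˢ_ : Series → Series → Series
(f -ˢ g) n = f n ℤ.- g n

_⋆_ : Series → Series → Series
(f ⋆ g) n = ℤΣ.sum {suc n} λ i → f (toℕ i) ℤ.* g (n ∸ toℕ i)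

_^ˢ_ : Series → ℕ → Series
f ^ˢ zero  = 1ˢ
f ^ˢ suc k = f ⋆ f ^ˢ k

∏[1⋯_] : ℕ → (ℕ → Series) → Series
∏[1⋯ zero  ] f = 1ˢ
∏[1⋯ suc N ] f = f (suc N) ⋆ ∏[1⋯ N ] f

-- The product of f m over all m ≥ 1, meaningful when f m ≡ 1 (mod q^m): the
-- coefficient of q^n in the partial products is then constant from N = n on
-- (∏∞-stable below).
∏∞ : (ℕ → Series) → Series
∏∞ f n = (∏[1⋯ n ] f) n

τ : ℕ → ℤ
τ = q^ 1 ⋆ ∏∞ (λ m → (1ˢ -ˢ q^ m) ^ˢ 24)

T : ℕ → ℤ
T n = τ (suc n)

Matrix : ℕ → Set
Matrix n = Fin n → Fin n → ℤ

-- Laplace expansion along the first row.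
det : ∀ {n} → Matrix n → ℤ
det {zero}  M = 1ℤ
det {suc n} M = ℤΣ.sum λ k →
  (-1ℤ ℤ.^ toℕ k) ℤ.* M zero k ℤ.* det (λ i → removeAt (M (suc i)) k)

-- Row and column numbers of H-entry start from 1.  The constant term h 0 is
-- never read; the normalisation h 0 = 1 holds for T by T₀≡1.
H-entry : (ℕ → ℤ) → ℕ → ℕ → ℤ
H-entry h i k =
  if k ≡ᵇ 1     then + i ℤ.* h i     else
  if k ≤ᵇ i     then h (i ∸ k + 1)   else
  if k ≡ᵇ i + 1 then 1ℤ              else 0ℤ

H : (n : ℕ) → (ℕ → ℤ) → Matrix n
H n h i k = H-entry h (suc (toℕ i)) (suc (toℕ k))

T₀≡1 : T 0 ≡ 1ℤ
T₀≡1 = refl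

infixr 5 ∑[1⋯]-syntax

∑[1⋯]-syntax : ℕ → (ℕ → ℚ) → ℚ
∑[1⋯]-syntax n F = ℚΣ.sum {n} λ i → F (suc (toℕ i))

syntax ∑[1⋯]-syntax n (λ k → x) = ∑[1≤ k ≤ n ] x

infix 4 _≡1modq^_

_≡1modq^_ : Series → ℕ → Set
f ≡1modq^ m = ∀ {j} → j < m → f j ≡ 1ˢ j

⋆-absorbˡ : ∀ {f m} g → f ≡1modq^ m → ∀ {n} → n < m → (f ⋆ g) n ≡ g n
⋆-absorbˡ {f} g f≡1 {n} n<m = begin
  f 0 ℤ.* g n ℤ.+ ℤΣ.sum rest  ≡⟨ cong₂ (λ a b → a ℤ.* g n ℤ.+ b)
                                    (f≡1 (≤-<-trans z≤n n<m)) rest≡0 ⟩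
  1ℤ ℤ.* g n ℤ.+ 0ℤ            ≡⟨ ℤ.+-identityʳ _ ⟩
  1ℤ ℤ.* g n                   ≡⟨ ℤ.*-identityˡ (g n) ⟩
  g n                          ∎
  where
  open ≡-Reasoning
  rest : Vector ℤ n
  rest i = f (suc (toℕ i)) ℤ.* g (n ∸ suc (toℕ i))
  rest≡0 : ℤΣ.sum rest ≡ 0ℤ
  rest≡0 = trans
    (ℤΣ.sum-cong-≗ λ i → cong (ℤ._* g (n ∸ suc (toℕ i)))
                              (f≡1 (≤-<-trans (toℕ<n i) n<m)))
    (ℤΣ.sum-replicate-zero n)

^ˢ-≡1 : ∀ {f m} → f ≡1modq^ m → ∀ k → f ^ˢ k ≡1modq^ m
^ˢ-≡1     f≡1 zero    j<m = refl
^ˢ-≡1 {f} f≡1 (suc k) j<m = trans (⋆-absorbˡ (f ^ˢ k) f≡1 j<m) (^ˢ-≡1 f≡1 k j<m)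

1-q^≡1 : ∀ m → 1ˢ -ˢ q^ m ≡1modq^ m
1-q^≡1 m {j} j<m = trans (cong (λ a → 1ˢ j ℤ.- a) (vanishes m j j<m))
                         (ℤ.+-identityʳ (1ˢ j))
  where
  vanishes : ∀ m j → j < m → (q^ m) j ≡ 0ℤ
  vanishes (suc m) zero    _         = refl
  vanishes (suc m) (suc j) (s≤s j<m) = vanishes m j j<m

∏∞-stable : ∀ f → (∀ m → f m ≡1modq^ m) →
            ∀ {n N} → n ≤ N → (∏[1⋯ N ] f) n ≡ ∏∞ f n
∏∞-stable f f≡1 {n} n≤N = go (≤⇒≤′ n≤N)
  where
  go : ∀ {N} → n ≤′ N → (∏[1⋯ N ] f) n ≡ ∏∞ f n
  go ≤′-refl              = refl
  go (≤′-step {N} n≤′N) =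
    trans (⋆-absorbˡ (∏[1⋯ N ] f) (f≡1 (suc N)) (s≤s (≤′⇒≤ n≤′N))) (go n≤′N)

τ-product-stable : ∀ {n N} → n ≤ N →
  (∏[1⋯ N ] λ m → (1ˢ -ˢ q^ m) ^ˢ 24) n ≡ ∏∞ (λ m → (1ˢ -ˢ q^ m) ^ˢ 24) n
τ-product-stable = ∏∞-stable (λ m → (1ˢ -ˢ q^ m) ^ˢ 24)
  (λ m → ^ˢ-≡1 {1ˢ -ˢ q^ m} {m} (1-q^≡1 m) 24)

private
  block : ℕ → ℕ → ℕ → List (List ℕ)
  block b n j = map (replicate j (suc b) ++_) (partitions≤ b (n ∸ j * suc b))

  cons : ∀ {b n ys} → IsPartition n ys × All (_≤ suc b) ys →
         IsPartition (suc b + n) (suc b ∷ ys) × All (_≤ suc b) (suc b ∷ ys)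
  cons {b} (isPartition lin pos sm , ≤b) =
    isPartition (AllPairs⇒Linked (≤b ∷ Linked⇒AllPairs (flip ≤-trans) lin))
                (z<s ∷ pos) (cong (λ s → suc b + s) sm)
    , ≤-refl ∷ ≤b

  prepend : ∀ {b n ys} j → IsPartition n ys × All (_≤ suc b) ys →
            IsPartition (j * suc b + n) (replicate j (suc b) ++ ys)
            × All (_≤ suc b) (replicate j (suc b) ++ ys)
  prepend         zero    P = P
  prepend {b} {n} {ys} (suc j) P =
    subst (λ s → IsPartition s xs × All (_≤ suc b) xs)
          (sym (+-assoc (suc b) (j * suc b) n)) (cons (prepend j P))
    where
    xs = suc b ∷ replicate j (suc b) ++ ys

  split : ∀ b {n} xs → IsPartition n xs → All (_≤ suc b) xs →
          ∃₂ λ j ys → xs ≡ replicate j (suc b) ++ ys × j * suc b ≤ n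
                    × IsPartition (n ∸ j * suc b) ys × All (_≤ b) ys
  split b [] P _ = 0 , [] , refl , z≤n , P , []
  split b (x ∷ xs) P@(isPartition lin (_ ∷ pos) refl) (x≤ ∷ xs≤) with x ≟ suc b
  ... | yes refl with split b xs (isPartition (Linked.tail lin) pos refl) xs≤
  ...   | j , ys , eq , le , Q , ys≤ =
    suc j , ys , cong (suc b ∷_) eq , +-monoʳ-≤ (suc b) le
    , subst (λ s → IsPartition s ys) (sym ([m+n]∸[m+o]≡n∸o (suc b) (sum xs) (j * suc b))) Q
    , ys≤
  split b (x ∷ xs) P@(isPartition lin _ refl) (x≤ ∷ _) | no x≢
    with Linked⇒AllPairs (flip ≤-trans) lin
  ... | xs≤x ∷ _ =
    0 , x ∷ xs , refl , z≤n , P , x≤b ∷ All.map (λ y≤x → ≤-trans y≤x x≤b) xs≤x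
    where
    x≤b : x ≤ b
    x≤b = s≤s⁻¹ (≤∧≢⇒< x≤ x≢)

  multiplicity : ∀ {b} i j {ys zs} → All (_≤ b) ys → All (_≤ b) zs →
                 replicate i (suc b) ++ ys ≡ replicate j (suc b) ++ zs → i ≡ j
  multiplicity zero    zero    _        _        _    = refl
  multiplicity zero    (suc j) (le ∷ _) _        refl = ⊥-elim (1+n≰n le)
  multiplicity (suc i) zero    _        (le ∷ _) refl = ⊥-elim (1+n≰n le)
  multiplicity (suc i) (suc j) ≤ys      ≤zs      eq   =
    cong suc (multiplicity i j ≤ys ≤zs (∷-injectiveʳ eq))

  bounded≤0 : ∀ {xs} → All (_> 0) xs → All (_≤ 0) xs → xs ≡ []
  bounded≤0 []        []        = refl
  bounded≤0 (x>0 ∷ _) (x≤0 ∷ _) = ⊥-elim (<⇒≱ x>0 x≤0)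

  parts≤sum : ∀ xs → All (_≤ sum xs) xs
  parts≤sum []       = []
  parts≤sum (x ∷ xs) =
    m≤m+n x (sum xs) ∷ All.map (λ le → ≤-trans le (m≤n+m (sum xs) x)) (parts≤sum xs)

∈-partitions≤⁻ : ∀ b n {xs} → xs ∈ partitions≤ b n →
                 IsPartition n xs × All (_≤ b) xs
∈-partitions≤⁻ zero    zero (here refl) = isPartition [] [] refl , []
∈-partitions≤⁻ (suc b) n    {xs} xs∈
  with find (∈-concatMap⁻ (block b n) {xs = upTo (suc (n / suc b))} xs∈)
... | j , j∈ , xs∈block with ∈-map⁻ (replicate j (suc b) ++_) xs∈block
...   | ys , ys∈ , refl with ∈-partitions≤⁻ b (n ∸ j * suc b) ys∈
...     | P , ys≤ =
  subst (λ s → IsPartition s xs × All (_≤ suc b) xs) (m+[n∸m]≡n j*b≤n)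
        (prepend j (P , All.map m≤n⇒m≤1+n ys≤))
  where
  j*b≤n : j * suc b ≤ n
  j*b≤n = ≤-trans
    (*-monoˡ-≤ (suc b) (s≤s⁻¹ (∈-upTo⁻ {n = suc (n / suc b)} j∈)))
    (m/n*n≤m n (suc b))

∈-partitions≤⁺ : ∀ b n {xs} → IsPartition n xs → All (_≤ b) xs →
                 xs ∈ partitions≤ b n
∈-partitions≤⁺ zero n (isPartition _ pos sm) xs≤ with bounded≤0 pos xs≤
∈-partitions≤⁺ zero zero (isPartition _ _ _) _ | refl = here refl
∈-partitions≤⁺ (suc b) n {xs} P xs≤ with split b xs P xs≤
... | j , ys , refl , le , Q , ys≤ =
  ∈-concatMap⁺ (block b n)
    (lose (∈-upTo⁺ (s≤s j≤n/b))
          (∈-map⁺ (replicate j (suc b) ++_) (∈-partitions≤⁺ b _ Q ys≤)))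
  where
  j≤n/b : j ≤ n / suc b
  j≤n/b = subst (_≤ n / suc b) (m*n/n≡m j (suc b)) (/-monoˡ-≤ (suc b) le)

partitions≤-unique : ∀ b n → Unique (partitions≤ b n)
partitions≤-unique zero    zero    = [] ∷ []
partitions≤-unique zero    (suc n) = []
partitions≤-unique (suc b) n       =
  Unique.concat⁺
    (All.map⁺ (All.universal (λ j → Unique.map⁺ (++-cancelˡ (replicate j (suc b)) _ _)
                                      (partitions≤-unique b (n ∸ j * suc b))) _))
    (AllPairs.map⁺ (AllPairs.map
      (λ {i} {j} i≢j {xs} (∈i , ∈j) → i≢j (same i j ∈i ∈j))
      (Unique.upTo⁺ (suc (n / suc b)))))
  where
  same : ∀ i j {xs} → xs ∈ block b n i → xs ∈ block b n j → i ≡ j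
  same i j ∈i ∈j with ∈-map⁻ (replicate i (suc b) ++_) ∈i
                    | ∈-map⁻ (replicate j (suc b) ++_) ∈j
  ... | ys , ys∈ , refl | zs , zs∈ , eq =
    multiplicity i j (proj₂ (∈-partitions≤⁻ b _ ys∈)) (proj₂ (∈-partitions≤⁻ b _ zs∈)) eq

∈-partitions⁺ : ∀ {n xs} → IsPartition n xs → xs ∈ partitions n
∈-partitions⁺ {xs = xs} P@(isPartition _ _ refl) = ∈-partitions≤⁺ _ _ P (parts≤sum xs)

∈-partitions⁻ : ∀ {n xs} → xs ∈ partitions n → IsPartition n xs
∈-partitions⁻ {n} = proj₁ ∘ ∈-partitions≤⁻ n n

partitions-unique : ∀ n → Unique (partitions n)
partitions-unique n = partitions≤-unique n n

{-# OPTIONS --safe #-}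

-- Let E = ∏ (1 - q^m), so that E P = 1 for the generating function P of the
-- partition numbers, and let D = q d/dq.  Expanding a determinant of the shape
-- of H along its first row shows, for every series h with h 0 = 1, that
-- (-1)^k |H_k(h)| is the coefficient of q^k in - D h / h.  Logarithmic
-- derivatives turn products into sums, so for h = E^24 this series is
-- - 24 D E / E = 24 D P / P; multiplying it by P gives 24 D P.  To read off the
-- coefficient of q^n, the infinite products are truncated at the factor m = n.
module Submission where

open import Defs
open import Data.Nat.Base using (ℕ; _∸_; _≥_)
open import Data.Integer.Base using (+_; -1ℤ; _^_)
open import Data.Rational.Base using (_/_; _*_)
open import Relation.Binary.PropositionalEquality using (_≡_)

open import Algebra.Bundles using (CommutativeRing)
import Algebra.Consequences.Setoid as Consequences
import Algebra.Construct.Pointwise as Pointwise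
import Algebra.Properties.CommutativeSemiring.Exp as Exp
import Algebra.Properties.Ring as RingProperties
import Algebra.Properties.Semiring.Mult as Mult
import Algebra.Properties.Semiring.Sum as Sum
import Algebra.Solver.Ring.NaturalCoefficients.Default as Solver
open import Data.Fin.Base using (Fin; zero; suc; toℕ; punchIn)
open import Data.Fin.Properties using (toℕ<n)
open import Data.Integer.Base as ℤ using (ℤ; 0ℤ; 1ℤ)
import Data.Integer.Properties as ℤ
open import Data.Integer.Tactic.RingSolver using (solve-∀)
open import Data.List.Base
  using (List; []; _∷_; _++_; map; concatMap; length; replicate; upTo; applyUpTo)
open import Data.List.Properties using (length-map; length-++; concatMap-map; map-upTo)
open import Data.Nat.Base as ℕ using (zero; suc; s≤s; _≤_; _<_)
import Data.Nat.DivMod as ℕ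
import Data.Nat.Properties as ℕ
open import Data.Rational.Base as ℚ using ()
import Data.Rational.Properties as ℚ
open import Data.Rational.Unnormalised.Base as ℚᵘ using (mkℚᵘ; *≡*)
import Data.Rational.Unnormalised.Properties as ℚᵘ
open import Data.Vec.Functional using (removeAt)
open import Function.Base using (_∘_)
open import Level using (0ℓ)
open import Relation.Binary.PropositionalEquality
  using (refl; sym; trans; cong; cong₂; subst; _≗_; module ≡-Reasoning)
open import Relation.Nullary using (yes; no)

module ℤΣ = Sum (CommutativeRing.semiring ℤ.+-*-commutativeRing)
module ℚΣ = Sum (CommutativeRing.semiring ℚ.+-*-commutativeRing)

-- The commutative ring of formal power series.

private
  variable
    f f′ g g′ : Series

infixl 6 _+ˢ_

_+ˢ_ : Series → Series → Series
(f +ˢ g) n = f n ℤ.+ g n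

0ˢ : Series
0ˢ _ = 0ℤ

-ˢ_ : Series → Series
(-ˢ f) n = ℤ.- f n

⋆-cong : f ≗ f′ → g ≗ g′ → f ⋆ g ≗ f′ ⋆ g′
⋆-cong f≗f′ g≗g′ n =
  ℤΣ.sum-cong-≗ {suc n} λ i → cong₂ ℤ._*_ (f≗f′ (toℕ i)) (g≗g′ (n ∸ toℕ i))

⋆-zeroˡ : ∀ f → 0ˢ ⋆ f ≗ 0ˢ
⋆-zeroˡ f zero    = refl
⋆-zeroˡ f (suc n) = cong (λ x → 0ℤ ℤ.+ x) (⋆-zeroˡ f n)

⋆-identityˡ : ∀ f → 1ˢ ⋆ f ≗ f
⋆-identityˡ f zero    = trans (ℤ.+-identityʳ _) (ℤ.*-identityˡ (f 0))
⋆-identityˡ f (suc n) = trans (cong₂ ℤ._+_ (ℤ.*-identityˡ (f (suc n))) (⋆-zeroˡ f n))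
                              (ℤ.+-identityʳ _)

⋆-distribʳ-+ˢ : ∀ h f g → (f +ˢ g) ⋆ h ≗ f ⋆ h +ˢ g ⋆ h
⋆-distribʳ-+ˢ h f g n = trans
  (ℤΣ.sum-cong-≗ {suc n} λ i → ℤ.*-distribʳ-+ (h (n ∸ toℕ i)) (f (toℕ i)) (g (toℕ i)))
  (ℤΣ.∑-distrib-+ {suc n} (λ i → f (toℕ i) ℤ.* h (n ∸ toℕ i))
                          (λ i → g (toℕ i) ℤ.* h (n ∸ toℕ i)))

⋆-scaleˡ : ∀ c f g → (λ n → c ℤ.* f n) ⋆ g ≗ λ n → c ℤ.* (f ⋆ g) n
⋆-scaleˡ c f g n = trans
  (ℤΣ.sum-cong-≗ {suc n} λ i → ℤ.*-assoc c (f (toℕ i)) (g (n ∸ toℕ i)))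
  (sym (ℤΣ.*-distribˡ-sum {suc n} c λ i → f (toℕ i) ℤ.* g (n ∸ toℕ i)))

⋆-assoc : ∀ f g h → (f ⋆ g) ⋆ h ≗ f ⋆ (g ⋆ h)
⋆-assoc f g h zero = lemma (f 0) (g 0) (h 0)
  where
  lemma : ∀ a b c → (a ℤ.* b ℤ.+ 0ℤ) ℤ.* c ℤ.+ 0ℤ ≡ a ℤ.* (b ℤ.* c ℤ.+ 0ℤ) ℤ.+ 0ℤ
  lemma = solve-∀
⋆-assoc f g h (suc n) = begin
  -- The tail of `f ⋆ g` is `f 0` times the tail of `g` plus `(f ∘ suc) ⋆ g`, so the induction
  -- hypothesis is needed at `f ∘ suc`.
  (f ⋆ g) 0 ℤ.* h (suc n) ℤ.+ (((λ m → f 0 ℤ.* g (suc m)) +ˢ (f ∘ suc) ⋆ g) ⋆ h) n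
    ≡⟨ cong (λ x → (f ⋆ g) 0 ℤ.* h (suc n) ℤ.+ x) (trans
         (⋆-distribʳ-+ˢ h (λ m → f 0 ℤ.* g (suc m)) ((f ∘ suc) ⋆ g) n)
         (cong₂ ℤ._+_ (⋆-scaleˡ (f 0) (g ∘ suc) h n) (⋆-assoc (f ∘ suc) g h n))) ⟩
  (f ⋆ g) 0 ℤ.* h (suc n) ℤ.+ (f 0 ℤ.* ((g ∘ suc) ⋆ h) n ℤ.+ ((f ∘ suc) ⋆ (g ⋆ h)) n)
    ≡⟨ lemma (f 0) (g 0) (h (suc n)) _ _ ⟩
  f 0 ℤ.* (g ⋆ h) (suc n) ℤ.+ ((f ∘ suc) ⋆ (g ⋆ h)) n ∎
  where
  open ≡-Reasoning
  lemma : ∀ a b c d e → (a ℤ.* b ℤ.+ 0ℤ) ℤ.* c ℤ.+ (a ℤ.* d ℤ.+ e) ≡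
                        a ℤ.* (b ℤ.* c ℤ.+ d) ℤ.+ e
  lemma = solve-∀

-- Unfolding `⋆` splits off the first coefficient of the left factor; this is the mirror image for
-- the right factor, and commutativity follows by comparing the two.
⋆-sucʳ : ∀ f g n → (f ⋆ g) (suc n) ≡ g 0 ℤ.* f (suc n) ℤ.+ (f ⋆ (g ∘ suc)) n
⋆-sucʳ f g zero = lemma (f 0) (f 1) (g 0) (g 1)
  where
  lemma : ∀ a b c d → a ℤ.* d ℤ.+ (b ℤ.* c ℤ.+ 0ℤ) ≡ c ℤ.* b ℤ.+ (a ℤ.* d ℤ.+ 0ℤ)
  lemma = solve-∀
⋆-sucʳ f g (suc n) = trans
  (cong (λ x → f 0 ℤ.* g (suc (suc n)) ℤ.+ x) (⋆-sucʳ (f ∘ suc) g n))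
  (lemma (f 0 ℤ.* g (suc (suc n))) (g 0 ℤ.* f (suc (suc n))) _)
  where
  lemma : ∀ a b c → a ℤ.+ (b ℤ.+ c) ≡ b ℤ.+ (a ℤ.+ c)
  lemma = solve-∀

⋆-comm : ∀ f g → f ⋆ g ≗ g ⋆ f
⋆-comm f g zero    = cong (ℤ._+ 0ℤ) (ℤ.*-comm (f 0) (g 0))
⋆-comm f g (suc n) = trans
  (cong (λ x → f 0 ℤ.* g (suc n) ℤ.+ x) (⋆-comm (f ∘ suc) g n))
  (sym (⋆-sucʳ g f n))

seriesRing : CommutativeRing 0ℓ 0ℓ
seriesRing = record
  { Carrier = Series
  ; _≈_     = _≗_
  ; _+_     = _+ˢ_
  ; _*_     = _⋆_
  ; -_      = -ˢ_
  ; 0#      = 0ˢ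
  ; 1#      = 1ˢ
  ; isCommutativeRing = record
    { isRing = record
      { +-isAbelianGroup = +-isAbelianGroup
      ; *-cong           = ⋆-cong
      ; *-assoc          = ⋆-assoc
      ; *-identity       = comm∧idˡ⇒id ⋆-comm ⋆-identityˡ
      ; distrib          = comm∧distrʳ⇒distr +-cong ⋆-comm ⋆-distribʳ-+ˢ
      }
    ; *-comm = ⋆-comm
    }
  }
  where
  open CommutativeRing (Pointwise.commutativeRing ℕ ℤ.+-*-commutativeRing)
    using (setoid; +-isAbelianGroup; +-cong)
  open Consequences setoid

private
  module ˢ where
    open CommutativeRing seriesRing public
    open Exp commutativeSemiring public
    open Mult semiring public
    open RingProperties ring public

open import Relation.Binary.Reasoning.Setoid ˢ.setoid

-- The derivation q d/dq and logarithmic derivatives.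

D : Series → Series
D f n = + n ℤ.* f n

D-cong : f ≗ g → D f ≗ D g
D-cong f≗g n = cong (λ x → + n ℤ.* x) (f≗g n)

+suc* : ∀ n a → + suc n ℤ.* a ≡ a ℤ.+ + n ℤ.* a
+suc* n a = ℤ.suc-* (+ n) a

D-⋆ : ∀ f g → D (f ⋆ g) ≗ D f ⋆ g +ˢ f ⋆ D g
D-⋆ f g zero = lemma (f 0) (g 0)
  where
  lemma : ∀ a b → 0ℤ ≡ (0ℤ ℤ.+ 0ℤ) ℤ.+ (a ℤ.* 0ℤ ℤ.+ 0ℤ)
  lemma = solve-∀
D-⋆ f g (suc n) = ≡.begin
  + suc n ℤ.* (f 0 ℤ.* g (suc n) ℤ.+ (f₊ ⋆ g) n)
    ≡.≡⟨ lemma₁ (+ suc n) (f 0) (g (suc n)) ((f₊ ⋆ g) n) ⟩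
  f 0 ℤ.* D g (suc n) ℤ.+ + suc n ℤ.* (f₊ ⋆ g) n
    -- The weight n + 1 is split as 1 + n: the part n is the induction hypothesis for the shifted
    -- series, and the part 1 turns `D f₊` into `D f ∘ suc` below.
    ≡.≡⟨ cong (λ x → f 0 ℤ.* D g (suc n) ℤ.+ x)
          (trans (+suc* n ((f₊ ⋆ g) n)) (cong (λ x → (f₊ ⋆ g) n ℤ.+ x) (D-⋆ f₊ g n))) ⟩
  f 0 ℤ.* D g (suc n) ℤ.+ ((f₊ ⋆ g) n ℤ.+ ((D f₊ ⋆ g) n ℤ.+ (f₊ ⋆ D g) n))
    ≡.≡⟨ lemma₂ (f 0 ℤ.* D g (suc n)) ((f₊ ⋆ g) n) ((D f₊ ⋆ g) n) ((f₊ ⋆ D g) n) ⟩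
  ((f₊ ⋆ g) n ℤ.+ (D f₊ ⋆ g) n) ℤ.+ (f 0 ℤ.* D g (suc n) ℤ.+ (f₊ ⋆ D g) n)
    ≡.≡⟨ cong (λ x → x ℤ.+ (f ⋆ D g) (suc n)) (trans
          (sym (⋆-distribʳ-+ˢ g f₊ (D f₊) n))
          (⋆-cong {g = g} (λ m → sym (+suc* m (f₊ m))) (λ _ → refl) n)) ⟩
  ((D f ∘ suc) ⋆ g) n ℤ.+ (f ⋆ D g) (suc n)
    ≡.≡⟨ cong (λ x → x ℤ.+ (f ⋆ D g) (suc n)) (sym (ℤ.+-identityˡ (((D f ∘ suc) ⋆ g) n))) ⟩
  (D f ⋆ g) (suc n) ℤ.+ (f ⋆ D g) (suc n) ≡.∎
  where
  module ≡ = ≡-Reasoning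
  f₊ : Series
  f₊ = f ∘ suc
  lemma₁ : ∀ s a b c → s ℤ.* (a ℤ.* b ℤ.+ c) ≡ a ℤ.* (s ℤ.* b) ℤ.+ s ℤ.* c
  lemma₁ = solve-∀
  lemma₂ : ∀ a b c d → a ℤ.+ (b ℤ.+ (c ℤ.+ d)) ≡ (b ℤ.+ c) ℤ.+ (a ℤ.+ d)
  lemma₂ = solve-∀

D-1ˢ : D 1ˢ ≗ 0ˢ
D-1ˢ zero    = refl
D-1ˢ (suc n) = ℤ.*-zeroʳ (+ suc n)

-- D f ⋆ g is the logarithmic derivative of f when g inverts f.
log-derivative-⋆ : ∀ f g f′ g′ → f ⋆ g ≗ 1ˢ → f′ ⋆ g′ ≗ 1ˢ →
                   D (f ⋆ f′) ⋆ (g ⋆ g′) ≗ D f ⋆ g +ˢ D f′ ⋆ g′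
log-derivative-⋆ f g f′ g′ fg≗1 f′g′≗1 = begin
  D (f ⋆ f′) ⋆ (g ⋆ g′)                            ≈⟨ ˢ.*-congʳ (D-⋆ f f′) ⟩
  (D f ⋆ f′ +ˢ f ⋆ D f′) ⋆ (g ⋆ g′)                ≈⟨ rearrange f g f′ g′ (D f) (D f′) ⟩
  D f ⋆ g ⋆ (f′ ⋆ g′) +ˢ D f′ ⋆ g′ ⋆ (f ⋆ g)       ≈⟨ ˢ.+-cong (ˢ.*-congˡ {D f ⋆ g} f′g′≗1)
                                                              (ˢ.*-congˡ {D f′ ⋆ g′} fg≗1) ⟩
  D f ⋆ g ⋆ 1ˢ +ˢ D f′ ⋆ g′ ⋆ 1ˢ                   ≈⟨ ˢ.+-cong (ˢ.*-identityʳ (D f ⋆ g))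
                                                              (ˢ.*-identityʳ (D f′ ⋆ g′)) ⟩
  D f ⋆ g +ˢ D f′ ⋆ g′                             ∎
  where
  open Solver ˢ.commutativeSemiring
  rearrange : ∀ f g f′ g′ d d′ →
              (d ⋆ f′ +ˢ f ⋆ d′) ⋆ (g ⋆ g′) ≗ d ⋆ g ⋆ (f′ ⋆ g′) +ˢ d′ ⋆ g′ ⋆ (f ⋆ g)
  rearrange = solve 6 (λ f g f′ g′ d d′ →
    (d :* f′ :+ f :* d′) :* (g :* g′) := d :* g :* (f′ :* g′) :+ d′ :* g′ :* (f :* g)) ˢ.refl

^-inverse : ∀ f g k → f ⋆ g ≗ 1ˢ → f ˢ.^ k ⋆ g ˢ.^ k ≗ 1ˢ
^-inverse f g k fg≗1 = begin
  f ˢ.^ k ⋆ g ˢ.^ k  ≈⟨ ˢ.^-distrib-* f g k ⟨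
  (f ⋆ g) ˢ.^ k      ≈⟨ ˢ.^-congˡ k fg≗1 ⟩
  1ˢ ˢ.^ k           ≈⟨ 1^ k ⟩
  1ˢ                 ∎
  where
  1^ : ∀ k → 1ˢ ˢ.^ k ≗ 1ˢ
  1^ zero    = ˢ.refl
  1^ (suc k) = ˢ.trans (ˢ.*-identityˡ (1ˢ ˢ.^ k)) (1^ k)

log-derivative-^ : ∀ f g k → f ⋆ g ≗ 1ˢ → D (f ˢ.^ k) ⋆ g ˢ.^ k ≗ k ˢ.× (D f ⋆ g)
log-derivative-^ f g zero    fg≗1 = ˢ.trans (ˢ.*-identityʳ (D 1ˢ)) D-1ˢ
log-derivative-^ f g (suc k) fg≗1 = begin
  D (f ⋆ f ˢ.^ k) ⋆ (g ⋆ g ˢ.^ k)     ≈⟨ log-derivative-⋆ f g (f ˢ.^ k) (g ˢ.^ k) fg≗1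
                                           (^-inverse f g k fg≗1) ⟩
  D f ⋆ g +ˢ D (f ˢ.^ k) ⋆ g ˢ.^ k    ≈⟨ ˢ.+-congˡ {D f ⋆ g} (log-derivative-^ f g k fg≗1) ⟩
  D f ⋆ g +ˢ k ˢ.× (D f ⋆ g)          ∎

-- Apply `D` to `f ⋆ g ≗ 1ˢ` and use the Leibniz rule.
log-derivative-inverse : ∀ f g → f ⋆ g ≗ 1ˢ → -ˢ (D f ⋆ g) ≗ D g ⋆ f
log-derivative-inverse f g fg≗1 = ˢ.sym (ˢ.+-inverseʳ-unique (D f ⋆ g) (D g ⋆ f) (begin
  D f ⋆ g +ˢ D g ⋆ f  ≈⟨ ˢ.+-congˡ {D f ⋆ g} (⋆-comm (D g) f) ⟩
  D f ⋆ g +ˢ f ⋆ D g  ≈⟨ D-⋆ f g ⟨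
  D (f ⋆ g)           ≈⟨ D-cong fg≗1 ⟩
  D 1ˢ                ≈⟨ D-1ˢ ⟩
  0ˢ                  ∎))

inverse-unique : ∀ f g g′ → f ⋆ g ≗ 1ˢ → f ⋆ g′ ≗ 1ˢ → g ≗ g′
inverse-unique f g g′ fg≗1 fg′≗1 = begin
  g             ≈⟨ ˢ.*-identityʳ g ⟨
  g ⋆ 1ˢ        ≈⟨ ˢ.*-congˡ {g} fg′≗1 ⟨
  g ⋆ (f ⋆ g′)  ≈⟨ ⋆-assoc g f g′ ⟨
  (g ⋆ f) ⋆ g′  ≈⟨ ˢ.*-congʳ (⋆-comm g f) ⟩
  (f ⋆ g) ⋆ g′  ≈⟨ ˢ.*-congʳ fg≗1 ⟩
  1ˢ ⋆ g′       ≈⟨ ⋆-identityˡ g′ ⟩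
  g′            ∎

-×-comm : ∀ k f → -ˢ (k ˢ.× f) ≗ k ˢ.× (-ˢ f)
-×-comm zero    f n = refl
-×-comm (suc k) f n =
  trans (ℤ.neg-distrib-+ (f n) _) (cong (λ x → ℤ.- f n ℤ.+ x) (-×-comm k f n))

-- The inverse `r` of the power is left arbitrary so that the one built from determinants can be
-- inserted; uniqueness of inverses identifies it with the k-th power of `f`.
log-derivative-power-inverse : ∀ e f r k → e ⋆ f ≗ 1ˢ → e ˢ.^ k ⋆ r ≗ 1ˢ →
                               -ˢ (D (e ˢ.^ k) ⋆ r) ⋆ f ≗ k ˢ.× D f
log-derivative-power-inverse e f r k ef≗1 eᵏr≗1 = begin
  -ˢ (D (e ˢ.^ k) ⋆ r) ⋆ f         ≈⟨ ˢ.*-congʳ {f} (ˢ.-‿cong (ˢ.*-congˡ {D (e ˢ.^ k)}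
                                      (inverse-unique (e ˢ.^ k) r (f ˢ.^ k) eᵏr≗1
                                        (^-inverse e f k ef≗1)))) ⟩
  -ˢ (D (e ˢ.^ k) ⋆ f ˢ.^ k) ⋆ f   ≈⟨ ˢ.*-congʳ {f} (ˢ.-‿cong (log-derivative-^ e f k ef≗1)) ⟩
  -ˢ (k ˢ.× (D e ⋆ f)) ⋆ f         ≈⟨ ˢ.*-congʳ {f} (-×-comm k (D e ⋆ f)) ⟩
  (k ˢ.× (-ˢ (D e ⋆ f))) ⋆ f       ≈⟨ ˢ.*-congʳ {f} (ˢ.×-congʳ k (log-derivative-inverse e f ef≗1)) ⟩
  (k ˢ.× (D f ⋆ e)) ⋆ f            ≈⟨ ˢ.×-assoc-* k (D f ⋆ e) f ⟩
  k ˢ.× (D f ⋆ e ⋆ f)              ≈⟨ ˢ.×-congʳ k (⋆-assoc (D f) e f) ⟩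
  k ˢ.× (D f ⋆ (e ⋆ f))            ≈⟨ ˢ.×-congʳ k (ˢ.*-congˡ {D f} ef≗1) ⟩
  k ˢ.× (D f ⋆ 1ˢ)                 ≈⟨ ˢ.×-congʳ k (ˢ.*-identityʳ (D f)) ⟩
  k ˢ.× D f                        ∎

×-coefficient : ∀ k f n → (k ˢ.× f) n ≡ + k ℤ.* f n
×-coefficient zero    f n = refl
×-coefficient (suc k) f n =
  trans (cong (λ x → f n ℤ.+ x) (×-coefficient k f n)) (sym (+suc* k (f n)))

-- Multiplication by powers of q, and powers of finite products.

q^-⋆-< : ∀ m f {n} → n < m → (q^ m ⋆ f) n ≡ 0ℤ
q^-⋆-< (suc m) f {zero}  _         = refl
q^-⋆-< (suc m) f {suc n} (s≤s n<m) = trans (ℤ.+-identityˡ _) (q^-⋆-< m f n<m)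

q^-⋆-+ : ∀ m f n → (q^ m ⋆ f) (m ℕ.+ n) ≡ f n
q^-⋆-+ zero    f n = ⋆-identityˡ f n
q^-⋆-+ (suc m) f n = trans (ℤ.+-identityˡ _) (q^-⋆-+ m f n)

^ˢ≗^ : ∀ f k → f ^ˢ k ≗ f ˢ.^ k
^ˢ≗^ f zero    = ˢ.refl
^ˢ≗^ f (suc k) = ˢ.*-congˡ {f} (^ˢ≗^ f k)

∏-^ : ∀ (f : ℕ → Series) k N → ∏[1⋯ N ] (λ m → f m ^ˢ k) ≗ (∏[1⋯ N ] f) ˢ.^ k
∏-^ f zero    zero    = ˢ.refl
∏-^ f (suc k) zero    = ˢ.trans (∏-^ f k zero) (ˢ.sym (⋆-identityˡ (1ˢ ˢ.^ k)))
∏-^ f k       (suc N) = begin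
  f (suc N) ^ˢ k ⋆ ∏[1⋯ N ] (λ m → f m ^ˢ k)  ≈⟨ ⋆-cong (^ˢ≗^ (f (suc N)) k) (∏-^ f k N) ⟩
  f (suc N) ˢ.^ k ⋆ (∏[1⋯ N ] f) ˢ.^ k        ≈⟨ ˢ.^-distrib-* (f (suc N)) (∏[1⋯ N ] f) k ⟨
  (f (suc N) ⋆ ∏[1⋯ N ] f) ˢ.^ k              ∎

-- Partitions with bounded parts and Euler's product.

P≤ : ℕ → Series
P≤ b n = + length (partitions≤ b n)

length-concatMap : ∀ {A B C : Set} (f : A → List B) (g : A → List C) →
                   (∀ x → length (f x) ≡ length (g x)) →
                   ∀ xs → length (concatMap f xs) ≡ length (concatMap g xs)
length-concatMap f g f≗g []       = refl
length-concatMap f g f≗g (x ∷ xs) = trans (length-++ (f x)) (trans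
  (cong₂ ℕ._+_ (f≗g x) (length-concatMap f g f≗g xs)) (sym (length-++ (g x))))

-- The quotient `n / suc b` is 0, so the enumeration consists of the block of multiplicity 0 alone.
length-partitions≤-< : ∀ b {n} → n < suc b →
                       length (partitions≤ (suc b) n) ≡ length (partitions≤ b n)
length-partitions≤-< b {n} n<b rewrite ℕ.m<n⇒m/n≡0 n<b = trans
  (length-++ (map (λ ys → ys) (partitions≤ b n)))
  (trans (ℕ.+-identityʳ _) (length-map (λ ys → ys) (partitions≤ b n)))

-- The block of multiplicity 0 gives the first summand. Removing one part `suc b` matches each block
-- of multiplicity j + 1 with the block of multiplicity j for `n`, which gives the second.
length-partitions≤-+ : ∀ b n → length (partitions≤ (suc b) (suc b ℕ.+ n)) ≡
  length (partitions≤ b (suc b ℕ.+ n)) ℕ.+ length (partitions≤ (suc b) n)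
length-partitions≤-+ b n
  rewrite ℕ.m/n≡1+[m∸n]/n {suc b ℕ.+ n} {suc b} (ℕ.m≤m+n (suc b) n)
        | ℕ.m+n∸m≡n b n = trans
  (length-++ (block (suc b ℕ.+ n) 0))
  (cong₂ ℕ._+_ (length-map (λ ys → ys) (partitions≤ b (suc b ℕ.+ n)))
    (≡.begin
      length (concatMap (block (suc b ℕ.+ n)) (applyUpTo suc k))
        ≡.≡⟨ cong (length ∘ concatMap (block (suc b ℕ.+ n))) (sym (map-upTo suc k)) ⟩
      length (concatMap (block (suc b ℕ.+ n)) (map suc (upTo k)))
        ≡.≡⟨ cong length (concatMap-map (block (suc b ℕ.+ n)) suc (upTo k)) ⟩
      length (concatMap (block (suc b ℕ.+ n) ∘ suc) (upTo k))
        ≡.≡⟨ length-concatMap (block (suc b ℕ.+ n) ∘ suc) (block n) blocks (upTo k) ⟩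
      length (concatMap (block n) (upTo k)) ≡.∎))
  where
  module ≡ = ≡-Reasoning
  k = suc (n ℕ./ suc b)
  block : ℕ → ℕ → List (List ℕ)
  block n j = map (replicate j (suc b) ++_) (partitions≤ b (n ∸ j ℕ.* suc b))
  blocks : ∀ j → length (block (suc b ℕ.+ n) (suc j)) ≡ length (block n j)
  blocks j = trans (length-map _ (partitions≤ b (suc b ℕ.+ n ∸ suc j ℕ.* suc b))) (trans
    (cong (length ∘ partitions≤ b) (ℕ.[m+n]∸[m+o]≡n∸o (suc b) n (j ℕ.* suc b)))
    (sym (length-map _ (partitions≤ b (n ∸ j ℕ.* suc b)))))

-- A partition either avoids the part `suc b` or contains a copy of it that can be removed. Below
-- degree `suc b` only the first case occurs.
P≤-suc : ∀ b → P≤ (suc b) ≗ P≤ b +ˢ q^ suc b ⋆ P≤ (suc b)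
P≤-suc b n with n ℕ.<? suc b
... | yes n<b = trans (cong +_ (length-partitions≤-< b n<b)) (trans
  (sym (ℤ.+-identityʳ _))
  (cong (λ x → P≤ b n ℤ.+ x) (sym (q^-⋆-< (suc b) (P≤ (suc b)) n<b))))
... | no n≮b = subst (λ n → P≤ (suc b) n ≡ (P≤ b +ˢ q^ suc b ⋆ P≤ (suc b)) n)
  (ℕ.m+[n∸m]≡n (ℕ.≮⇒≥ n≮b)) (shifted (n ∸ suc b))
  where
  shifted : ∀ m → P≤ (suc b) (suc b ℕ.+ m) ≡ (P≤ b +ˢ q^ suc b ⋆ P≤ (suc b)) (suc b ℕ.+ m)
  shifted m = trans (cong +_ (length-partitions≤-+ b m))
    (cong (λ x → P≤ b (suc b ℕ.+ m) ℤ.+ x) (sym (q^-⋆-+ (suc b) (P≤ (suc b)) m)))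

P≤-stable : ∀ {n b} → n ≤ b → P≤ b n ≡ + p n
P≤-stable {n} n≤b = go (ℕ.≤⇒≤′ n≤b)
  where
  go : ∀ {b} → n ℕ.≤′ b → P≤ b n ≡ + p n
  go ℕ.≤′-refl           = refl
  go (ℕ.≤′-step {b} n≤b) =
    trans (cong +_ (length-partitions≤-< b (s≤s (ℕ.≤′⇒≤ n≤b)))) (go n≤b)

P≤-0 : P≤ 0 ≗ 1ˢ
P≤-0 zero    = refl
P≤-0 (suc n) = refl

E≤ : ℕ → Series
E≤ N = ∏[1⋯ N ] λ m → 1ˢ -ˢ q^ m

-- Euler's identity for parts at most `b`: by `P≤-suc`, the new factor `1ˢ -ˢ q^ suc b` takes
-- `P≤ (suc b)` back to `P≤ b`.
E≤⋆P≤≗1 : ∀ b → E≤ b ⋆ P≤ b ≗ 1ˢ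
E≤⋆P≤≗1 zero    = ˢ.trans (⋆-identityˡ (P≤ 0)) P≤-0
E≤⋆P≤≗1 (suc b) = begin
  (1ˢ -ˢ q) ⋆ E≤ b ⋆ P≤ (suc b)    ≈⟨ ˢ.*-congʳ {P≤ (suc b)} (⋆-comm (1ˢ -ˢ q) (E≤ b)) ⟩
  E≤ b ⋆ (1ˢ -ˢ q) ⋆ P≤ (suc b)    ≈⟨ ⋆-assoc (E≤ b) (1ˢ -ˢ q) (P≤ (suc b)) ⟩
  E≤ b ⋆ ((1ˢ -ˢ q) ⋆ P≤ (suc b))  ≈⟨ ˢ.*-congˡ {E≤ b} cancel ⟩
  E≤ b ⋆ P≤ b                      ≈⟨ E≤⋆P≤≗1 b ⟩
  1ˢ                               ∎
  where
  q : Series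
  q = q^ suc b
  cancel : (1ˢ -ˢ q) ⋆ P≤ (suc b) ≗ P≤ b
  cancel n = trans (⋆-distribʳ-+ˢ (P≤ (suc b)) 1ˢ (-ˢ q) n) (trans
    (cong₂ ℤ._+_ (trans (⋆-identityˡ (P≤ (suc b)) n) (P≤-suc b n))
                 (sym (ˢ.-‿distribˡ-* q (P≤ (suc b)) n)))
    (lemma (P≤ b n) ((q ⋆ P≤ (suc b)) n)))
    where
    lemma : ∀ a b → (a ℤ.+ b) ℤ.+ ℤ.- b ≡ a
    lemma = solve-∀

-- Hessenberg determinants as power series coefficients.

det-cong : ∀ {n} {M M′ : Matrix n} → (∀ i j → M i j ≡ M′ i j) → det M ≡ det M′
det-cong {zero}  M≗M′ = refl
det-cong {suc n} {M} {M′} M≗M′ = ℤΣ.sum-cong-≗ {suc n} λ k →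
  cong₂ (λ x y → (-1ℤ ℤ.^ toℕ k) ℤ.* x ℤ.* y) (M≗M′ zero k)
        (det-cong λ i j → M≗M′ (suc i) (punchIn k j))

-- `lag h k i` is the coefficient of q^i in q^k h. The recursion makes it invariant by definition
-- under raising both indices, which is what deleting a row and a column requires.
lag : (ℕ → ℤ) → ℕ → ℕ → ℤ
lag h zero    i       = h i
lag h (suc k) zero    = 0ℤ
lag h (suc k) (suc i) = lag h k i

lag-cong : ∀ {h h′} k i → (∀ j → j ≤ i → h j ≡ h′ j) → lag h k i ≡ lag h′ k i
lag-cong zero    i       h≗h′ = h≗h′ i ℕ.≤-refl
lag-cong (suc k) zero    h≗h′ = refl
lag-cong (suc k) (suc i) h≗h′ = lag-cong k i λ j j≤i → h≗h′ j (ℕ.m≤n⇒m≤1+n j≤i)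

-- The matrices H with an arbitrary first column, a family closed under
-- deleting the first row and either of the first two columns.
hessenberg : (n : ℕ) → (ℕ → ℤ) → (ℕ → ℤ) → Matrix n
hessenberg n a h i zero    = a (toℕ i)
hessenberg n a h i (suc k) = lag h (toℕ k) (toℕ i)

-- The first row is `a 0`, `h 0`, 0, ..., 0, so only two minors survive. Deleting the first column
-- promotes the next one, with tail `h ∘ suc`; deleting the second leaves the tail of `a` in front.
det-hessenberg : ∀ n a h → h 0 ≡ 1ℤ →
  det (hessenberg (suc (suc n)) a h) ≡
  a 0 ℤ.* det (hessenberg (suc n) (h ∘ suc) h) ℤ.- det (hessenberg (suc n) (a ∘ suc) h)
det-hessenberg n a h h₀≡1 = trans
  (cong₂ ℤ._+_ (cong (λ x → 1ℤ ℤ.* a 0 ℤ.* x) (det-cong minor₀))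
    (cong₂ ℤ._+_ (cong₂ (λ x y → -1ℤ ℤ.* 1ℤ ℤ.* x ℤ.* y) h₀≡1 (det-cong minor₁))
                 rest≡0))
  (lemma (a 0) _ _)
  where
  minor₀ : ∀ i k → removeAt (hessenberg (suc (suc n)) a h (suc i)) zero k ≡
                   hessenberg (suc n) (h ∘ suc) h i k
  minor₀ i zero    = refl
  minor₀ i (suc k) = refl
  minor₁ : ∀ i k → removeAt (hessenberg (suc (suc n)) a h (suc i)) (suc zero) k ≡
                   hessenberg (suc n) (a ∘ suc) h i k
  minor₁ i zero    = refl
  minor₁ i (suc k) = refl
  rest : Fin n → ℤ
  rest k = det {suc n} λ i → removeAt (hessenberg (suc (suc n)) a h (suc i)) (suc (suc k))
  rest≡0 : ℤΣ.sum (λ (k : Fin n) → (-1ℤ ℤ.^ suc (suc (toℕ k))) ℤ.* 0ℤ ℤ.* rest k) ≡ 0ℤ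
  rest≡0 = trans
    (ℤΣ.sum-cong-≗ {n} λ k → cong (ℤ._* rest k) (ℤ.*-zeroʳ (-1ℤ ℤ.^ suc (suc (toℕ k)))))
    (ℤΣ.sum-replicate-zero n)
  lemma : ∀ a x y → 1ℤ ℤ.* a ℤ.* x ℤ.+ (-1ℤ ℤ.* 1ℤ ℤ.* 1ℤ ℤ.* y ℤ.+ 0ℤ) ≡ a ℤ.* x ℤ.- y
  lemma = solve-∀

-- Wronski's determinant formula for the coefficients of 1/h when `h 0 ≡ 1ℤ`.
inverse : Series → Series
inverse h n = -1ℤ ℤ.^ n ℤ.* det (hessenberg n (h ∘ suc) h)

-- The two terms of `det-hessenberg` are the head and the tail of the convolution: the first minor
-- is a coefficient of `inverse h` up to sign, and the second is the same problem for `a ∘ suc`, so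
-- the induction runs over all `a`.
signed-det-hessenberg : ∀ h → h 0 ≡ 1ℤ → ∀ n a →
  -1ℤ ℤ.^ suc n ℤ.* det (hessenberg (suc n) a h) ≡ ℤ.- (a ⋆ inverse h) n
signed-det-hessenberg h h₀≡1 zero    a = lemma (a 0)
  where
  lemma : ∀ a → -1ℤ ℤ.* 1ℤ ℤ.* (1ℤ ℤ.* a ℤ.* 1ℤ ℤ.+ 0ℤ) ≡ ℤ.- (a ℤ.* (1ℤ ℤ.* 1ℤ) ℤ.+ 0ℤ)
  lemma = solve-∀
signed-det-hessenberg h h₀≡1 (suc n) a = ≡.begin
  -1ℤ ℤ.* s ℤ.* det (hessenberg (suc (suc n)) a h)
    ≡.≡⟨ cong (λ x → -1ℤ ℤ.* s ℤ.* x) (det-hessenberg n a h h₀≡1) ⟩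
  -1ℤ ℤ.* s ℤ.* (a 0 ℤ.* d ℤ.- d₊)
    ≡.≡⟨ lemma₁ s (a 0) d d₊ ⟩
  ℤ.- (a 0 ℤ.* (s ℤ.* d)) ℤ.+ s ℤ.* d₊
    ≡.≡⟨ cong (λ x → ℤ.- (a 0 ℤ.* (s ℤ.* d)) ℤ.+ x)
              (signed-det-hessenberg h h₀≡1 n (a ∘ suc)) ⟩
  ℤ.- (a 0 ℤ.* (s ℤ.* d)) ℤ.+ ℤ.- ((a ∘ suc) ⋆ inverse h) n
    ≡.≡⟨ sym (ℤ.neg-distrib-+ (a 0 ℤ.* (s ℤ.* d)) (((a ∘ suc) ⋆ inverse h) n)) ⟩
  ℤ.- (a ⋆ inverse h) (suc n) ≡.∎
  where
  module ≡ = ≡-Reasoning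
  s  = -1ℤ ℤ.^ suc n
  d  = det (hessenberg (suc n) (h ∘ suc) h)
  d₊ = det (hessenberg (suc n) (a ∘ suc) h)
  lemma₁ : ∀ s a d e → -1ℤ ℤ.* s ℤ.* (a ℤ.* d ℤ.- e) ≡ ℤ.- (a ℤ.* (s ℤ.* d)) ℤ.+ s ℤ.* e
  lemma₁ = solve-∀

-- For the first column `h ∘ suc`, the left side of `signed-det-hessenberg` is itself
-- `inverse h (suc n)`, and it cancels the rest of the convolution.
⋆-inverse : ∀ h → h 0 ≡ 1ℤ → h ⋆ inverse h ≗ 1ˢ
⋆-inverse h h₀≡1 zero    rewrite h₀≡1 = refl
⋆-inverse h h₀≡1 (suc n) rewrite h₀≡1 = trans
  (cong (λ x → 1ℤ ℤ.* x ℤ.+ ((h ∘ suc) ⋆ inverse h) n)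
        (signed-det-hessenberg h h₀≡1 n (h ∘ suc)))
  (lemma (((h ∘ suc) ⋆ inverse h) n))
  where
  lemma : ∀ a → 1ℤ ℤ.* ℤ.- a ℤ.+ a ≡ 0ℤ
  lemma = solve-∀

-- The superdiagonal is a literal 1 in `H-entry` but `h 0` in `lag`; the normalisation makes them
-- agree.
H-entry-lag : ∀ h → h 0 ≡ 1ℤ → ∀ k i → H-entry h (suc i) (suc (suc k)) ≡ lag h k i
H-entry-lag h h₀≡1 zero    zero    = sym h₀≡1
H-entry-lag h h₀≡1 zero    (suc i) = cong h (ℕ.+-comm i 1)
H-entry-lag h h₀≡1 (suc k) zero    = refl
H-entry-lag h h₀≡1 (suc k) (suc i) = H-entry-lag h h₀≡1 k i

H-hessenberg : ∀ h → h 0 ≡ 1ℤ → ∀ n i k → H n h i k ≡ hessenberg n (D h ∘ suc) h i k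
H-hessenberg h h₀≡1 n i zero    = refl
H-hessenberg h h₀≡1 n i (suc k) = H-entry-lag h h₀≡1 (toℕ k) (toℕ i)

det-H : ∀ h → h 0 ≡ 1ℤ → ∀ n →
        -1ℤ ℤ.^ suc n ℤ.* det (H (suc n) h) ≡ (-ˢ (D h ⋆ inverse h)) (suc n)
det-H h h₀≡1 n = trans
  (cong (λ x → -1ℤ ℤ.^ suc n ℤ.* x) (det-cong (H-hessenberg h h₀≡1 (suc n))))
  (trans (signed-det-hessenberg h h₀≡1 n (D h ∘ suc))
         -- The first column of `H` is `D h` without its constant term; that term is 0, so restoring
         -- it leaves the convolution unchanged.
         (cong ℤ.-_ (sym (ℤ.+-identityˡ (((D h ∘ suc) ⋆ inverse h) n)))))

-- The entries involve coefficients up to degree `n` only, which permits replacing `T` by a power of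
-- a finite product.
det-H-cong : ∀ {h h′} n → h 0 ≡ 1ℤ → h′ 0 ≡ 1ℤ → (∀ j → j ≤ n → h j ≡ h′ j) →
             det (H n h) ≡ det (H n h′)
det-H-cong {h} {h′} n h₀≡1 h′₀≡1 h≗h′ = det-cong entry
  where
  entry : ∀ i k → H n h i k ≡ H n h′ i k
  entry i zero    = cong (λ x → + suc (toℕ i) ℤ.* x) (h≗h′ (suc (toℕ i)) (toℕ<n i))
  entry i (suc k) = trans (H-entry-lag h h₀≡1 (toℕ k) (toℕ i)) (trans
    (lag-cong (toℕ k) (toℕ i) λ j j≤i → h≗h′ j (ℕ.≤-trans j≤i (ℕ.<⇒≤ (toℕ<n i))))
    (sym (H-entry-lag h′ h′₀≡1 (toℕ k) (toℕ i))))

-- Truncated products and the integral recurrence.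

T-truncated : ∀ {n N} → n ≤ N → T n ≡ (E≤ N ˢ.^ 24) n
T-truncated {n} {N} n≤N = ≡.begin
  -- The index shift in `T` undoes the factor `q^ 1` in `τ`.
  T n                                             ≡.≡⟨ ℤ.+-identityˡ _ ⟩
  (1ˢ ⋆ ∏∞ F) n                                   ≡.≡⟨ ⋆-identityˡ (∏∞ F) n ⟩
  ∏∞ F n                                          ≡.≡⟨ sym (τ-product-stable n≤N) ⟩
  (∏[1⋯ N ] F) n                                  ≡.≡⟨ ∏-^ (λ m → 1ˢ -ˢ q^ m) 24 N n ⟩
  (E≤ N ˢ.^ 24) n                                 ≡.∎
  where
  module ≡ = ≡-Reasoning
  F : ℕ → Series
  F m = (1ˢ -ˢ q^ m) ^ˢ 24

det-H-recurrence : ∀ e f k → e ⋆ f ≗ 1ˢ → (e ˢ.^ k) 0 ≡ 1ℤ → ∀ n →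
  + k ℤ.* (+ n ℤ.* f n) ≡ ℤΣ.sum {n} λ i →
    -1ℤ ℤ.^ suc (toℕ i) ℤ.* det (H (suc (toℕ i)) (e ˢ.^ k)) ℤ.* f (n ∸ suc (toℕ i))
det-H-recurrence e f k ef≗1 h₀≡1 n = ≡.begin
  + k ℤ.* D f n
    ≡.≡⟨ sym (×-coefficient k (D f) n) ⟩
  (k ˢ.× D f) n
    ≡.≡⟨ sym (log-derivative-power-inverse e f (inverse h) k ef≗1
                (⋆-inverse h h₀≡1) n) ⟩
  (S ⋆ f) n
    -- `S` has constant term 0 because `D h` does, so the sum starts at index 1.
    ≡.≡⟨ ℤ.+-identityˡ _ ⟩
  ℤΣ.sum {n} (λ i → S (suc (toℕ i)) ℤ.* f (n ∸ suc (toℕ i)))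
    ≡.≡⟨ ℤΣ.sum-cong-≗ {n} (λ i → cong (ℤ._* f (n ∸ suc (toℕ i))) (sym (det-H h h₀≡1 (toℕ i)))) ⟩
  ℤΣ.sum {n} (λ i → -1ℤ ℤ.^ suc (toℕ i) ℤ.* det (H (suc (toℕ i)) h) ℤ.* f (n ∸ suc (toℕ i))) ≡.∎
  where
  module ≡ = ≡-Reasoning
  h S : Series
  h = e ˢ.^ k
  S = -ˢ (D h ⋆ inverse h)

det-H-partitions : ∀ k h n → h 0 ≡ 1ℤ → (∀ j → j ≤ n → h j ≡ (E≤ n ˢ.^ k) j) →
  + k ℤ.* (+ n ℤ.* + p n) ≡
  ℤΣ.sum {n} λ i → -1ℤ ℤ.^ suc (toℕ i) ℤ.* det (H (suc (toℕ i)) h) ℤ.* + p (n ∸ suc (toℕ i))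
det-H-partitions k h n h₀≡1 h≗Eᵏ = ≡.begin
  + k ℤ.* (+ n ℤ.* + p n)
    ≡.≡⟨ cong (λ x → + k ℤ.* (+ n ℤ.* x)) (sym (P≤-stable {n} ℕ.≤-refl)) ⟩
  + k ℤ.* (+ n ℤ.* P≤ n n)
    ≡.≡⟨ det-H-recurrence (E≤ n) (P≤ n) k (E≤⋆P≤≗1 n) Eᵏ₀≡1 n ⟩
  ℤΣ.sum {n} (λ i →
      -1ℤ ℤ.^ suc (toℕ i) ℤ.* det (H (suc (toℕ i)) (E≤ n ˢ.^ k)) ℤ.* P≤ n (n ∸ suc (toℕ i)))
    ≡.≡⟨ ℤΣ.sum-cong-≗ {n} (λ i → cong₂ (λ x y → -1ℤ ℤ.^ suc (toℕ i) ℤ.* x ℤ.* y)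
           (det-H-cong (suc (toℕ i)) Eᵏ₀≡1 h₀≡1 λ j j≤i → sym (h≗Eᵏ j (ℕ.≤-trans j≤i (toℕ<n i))))
           (P≤-stable (ℕ.m∸n≤m n (suc (toℕ i))))) ⟩
  ℤΣ.sum {n} (λ i → -1ℤ ℤ.^ suc (toℕ i) ℤ.* det (H (suc (toℕ i)) h) ℤ.* + p (n ∸ suc (toℕ i))) ≡.∎
  where
  module ≡ = ≡-Reasoning
  Eᵏ₀≡1 : (E≤ n ˢ.^ k) 0 ≡ 1ℤ
  Eᵏ₀≡1 = trans (sym (h≗Eᵏ 0 ℕ.z≤n)) h₀≡1

-- Passage from integers to rationals.

/-homo-+ : ∀ i j → (i / 1) ℚ.+ (j / 1) ≡ (i ℤ.+ j) / 1
/-homo-+ i j = ℚ.toℚᵘ-injective (ℚᵘ.≃-trans (ℚ.toℚᵘ-homo-+ (i / 1) (j / 1)) (ℚᵘ.≃-trans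
  (ℚᵘ.+-cong (ℚ.toℚᵘ-fromℚᵘ (mkℚᵘ i 0)) (ℚ.toℚᵘ-fromℚᵘ (mkℚᵘ j 0)))
  (ℚᵘ.≃-trans (*≡* (lemma i j)) (ℚᵘ.≃-sym (ℚ.toℚᵘ-fromℚᵘ (mkℚᵘ (i ℤ.+ j) 0))))))
  where
  lemma : ∀ i j → (i ℤ.* 1ℤ ℤ.+ j ℤ.* 1ℤ) ℤ.* 1ℤ ≡ (i ℤ.+ j) ℤ.* 1ℤ
  lemma = solve-∀

/-homo-* : ∀ i d j e .{{_ : ℕ.NonZero (suc d ℕ.* suc e)}} →
           (i / suc d) * (j / suc e) ≡ (i ℤ.* j) / (suc d ℕ.* suc e)
/-homo-* i d j e = ℚ.toℚᵘ-injective (ℚᵘ.≃-trans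
  (ℚ.toℚᵘ-homo-* (i / suc d) (j / suc e)) (ℚᵘ.≃-trans
  (ℚᵘ.*-cong (ℚ.toℚᵘ-fromℚᵘ (mkℚᵘ i d)) (ℚ.toℚᵘ-fromℚᵘ (mkℚᵘ j e)))
  (ℚᵘ.≃-sym (ℚ.toℚᵘ-fromℚᵘ (mkℚᵘ (i ℤ.* j) (e ℕ.+ d ℕ.* suc e))))))

sum-/ : ∀ n (x : Fin n → ℤ) → ℚΣ.sum (λ i → x i / 1) ≡ ℤΣ.sum x / 1
sum-/ zero    x = refl
sum-/ (suc n) x = trans
  (cong (λ y → (x zero / 1) ℚ.+ y) (sum-/ n (x ∘ suc)))
  (/-homo-+ (x zero) (ℤΣ.sum (x ∘ suc)))

theorem3p5 : (n : ℕ) → n ≥ 1 →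
    (+ n / 1) * (+ p n / 1) ≡
    (∑[1≤ k ≤ n ] ((-1ℤ ^ k) / 24) * (det (H k T) / 1) * (+ p (n ∸ k) / 1))
theorem3p5 n _ = ≡.begin
  (+ n / 1) * (+ p n / 1)
    ≡.≡⟨ /-homo-* (+ n) 0 (+ p n) 0 ⟩
  (+ n ℤ.* + p n) / 1
    -- The product of 1/24 and 24 evaluates to 1; the factor 24 is then absorbed by the integral
    -- recurrence, and 1/24 is distributed over the sum.
    ≡.≡⟨ sym (ℚ.*-identityˡ ((+ n ℤ.* + p n) / 1)) ⟩
  (+ 1 / 24) * (+ 24 / 1) * ((+ n ℤ.* + p n) / 1)
    ≡.≡⟨ ℚ.*-assoc (+ 1 / 24) (+ 24 / 1) ((+ n ℤ.* + p n) / 1) ⟩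
  (+ 1 / 24) * ((+ 24 / 1) * ((+ n ℤ.* + p n) / 1))
    ≡.≡⟨ cong ((+ 1 / 24) *_) (trans (/-homo-* (+ 24) 0 (+ n ℤ.* + p n) 0)
           (cong (_/ 1) (det-H-partitions 24 T n T₀≡1 λ _ → T-truncated))) ⟩
  (+ 1 / 24) * (ℤΣ.sum x / 1)
    ≡.≡⟨ cong ((+ 1 / 24) *_) (sym (sum-/ n x)) ⟩
  (+ 1 / 24) * ℚΣ.sum (λ i → x i / 1)
    ≡.≡⟨ ℚΣ.*-distribˡ-sum (+ 1 / 24) (λ i → x i / 1) ⟩
  ℚΣ.sum (λ i → (+ 1 / 24) * (x i / 1))
    ≡.≡⟨ ℚΣ.sum-cong-≗ {n} (λ i →
           term (-1ℤ ^ suc (toℕ i)) (det (H (suc (toℕ i)) T)) (+ p (n ∸ suc (toℕ i)))) ⟩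
  (∑[1≤ k ≤ n ] ((-1ℤ ^ k) / 24) * (det (H k T) / 1) * (+ p (n ∸ k) / 1)) ≡.∎
  where
  module ≡ = ≡-Reasoning
  x : Fin n → ℤ
  x i = -1ℤ ^ suc (toℕ i) ℤ.* det (H (suc (toℕ i)) T) ℤ.* + p (n ∸ suc (toℕ i))
  term : ∀ a b c → (+ 1 / 24) * ((a ℤ.* b ℤ.* c) / 1) ≡ (a / 24) * (b / 1) * (c / 1)
  -- `/-homo-*` takes predecessors of denominators, so 23 and 0 stand for 24 and 1.
  term a b c = trans (/-homo-* (+ 1) 23 (a ℤ.* b ℤ.* c) 0) (trans
    (cong (_/ 24) (ℤ.*-identityˡ (a ℤ.* b ℤ.* c)))
    (sym (trans (cong (_* (c / 1)) (/-homo-* a 23 b 0)) (/-homo-* (a ℤ.* b) 23 c 0))))
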